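{- For every integer $k\ge 1$, let $\mathcal{L}^2(k)=\gcd\{\sum_{i=1}^k L_{n+i}^2 : n \ge 0\}$. Then $$\mathcal{L}^2(k) = \begin{cases} 5F_k, & \text{if $k$ is even},\\ 2, & \text{if $k \equiv 3 \pmod{6}$},\\ 1, & \text{if $k \equiv 1,5 \pmod{6}$}.\end{cases}$$
   Context: $(L_n)$ is the Lucas sequence: $L_0=2$, $L_1=1$, $L_n=L_{n-1}+L_{n-2}$; $(F_n)$ is the Fibonacci sequence: $F_0=0$, $F_1=1$, $F_n=F_{n-1}+F_{n-2}$. -}

module Defs where

open import Data.List.Base using (applyUpTo)
open import Data.Nat.Base using (ℕ; zero; suc; _+_; _^_)
open import Data.Nat.Divisibility using (_∣_; ∣-antisym)
open import Data.Nat.ListAction using (sum)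
open import Relation.Binary.PropositionalEquality using (_≡_)

F : ℕ → ℕ
F zero          = 0
F (suc zero)    = 1
F (suc (suc n)) = F (suc n) + F n

L : ℕ → ℕ
L zero          = 2
L (suc zero)    = 1
L (suc (suc n)) = L (suc n) + L n

-- ∑_{i=1}^{k} L_{n+i}²; applyUpTo runs over j = 0, …, k - 1, so i = suc j.
lucasSquareSum : ℕ → ℕ → ℕ
lucasSquareSum k n = sum (applyUpTo (λ j → L (n + suc j) ^ 2) k)

-- d is the gcd of the infinite set { a n : n ≥ 0 }. As in the binary
-- Data.Nat.GCD.GCD, "greatest" refers to the divisibility order.
record IsGCD (a : ℕ → ℕ) (d : ℕ) : Set where
  field
    commonDivisor : ∀ n → d ∣ a n
    greatest      : ∀ {c} → (∀ n → c ∣ a n) → c ∣ d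

-- Hence IsGCD a d may be read as the equation gcd { a n : n ≥ 0 } = d.
IsGCD-unique : ∀ {a d e} → IsGCD a d → IsGCD a e → d ≡ e
IsGCD-unique p q = ∣-antisym
  (IsGCD.greatest q (IsGCD.commonDivisor p))
  (IsGCD.greatest p (IsGCD.commonDivisor q))

{-# OPTIONS --safe #-}
-- Two consecutive squares satisfy L_m² + L_{m+1}² = 5 F_{2m+1}; pairing terms gives
-- S_k(n) = 5 F_k F_{2n+k+1} for the sum S_k(n) of k squares with k even, and consecutive Fibonacci
-- numbers are coprime. For k odd, S_k(n) + S_k(n+1) = S_{k+1}(n) + S_{k-1}(n+1) is a sum over
-- even lengths, equal to 5 L_k F_{2n+k+2}. A common divisor c thus divides 5 L_k, and then 10, because
-- S_k(0) + 2 = L_k L_{k+1}. Since S_k(0) is L_k² plus a multiple of 5, and no Lucas number is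
-- divisible by 5, c divides 2; the parity of S_k(n) depends only on k mod 3.
module Submission where

open import Defs
open import Data.Empty using (⊥-elim)
open import Data.List.Base using (applyUpTo; _∷ʳ_)
open import Data.List.Properties using (applyUpTo-∷ʳ)
open import Data.Nat.Base using (ℕ; zero; suc; _+_; _*_; _^_; _/_; _%_; _≤_)
open import Data.Nat.Coprimality using (Coprime; coprime-divisor)
open import Data.Nat.Divisibility using
  ( _∣_; _∤_; divides; _∣?_; _∣0; 1∣_; ∣-reflexive; ∣-trans; m∣m*n; ∣m⇒∣m*n; ∣n⇒∣m*n
  ; ∣m∣n⇒∣m+n; ∣m+n∣m⇒∣n)
open import Data.Nat.DivMod using (m≡m%n+[m/n]*n)
open import Data.Nat.ListAction using (sum)
open import Data.Nat.ListAction.Properties using (sum-++)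
open import Data.Nat.Primality using (prime?; prime[2]; prime⇒irreducible; euclidsLemma; Prime)
open import Data.Nat.Properties using
  ( +-comm; +-suc; +-identityʳ; +-commutativeSemigroup
  ; *-assoc; *-identityˡ; *-identityʳ; *-distribˡ-+; *-distribʳ-+)
open import Data.Nat.Tactic.RingSolver using (solve-∀)
open import Data.Product.Base using (_×_; _,_; ∃-syntax)
open import Data.Sum.Base using (_⊎_; inj₁; inj₂; [_,_]′)
open import Relation.Binary.PropositionalEquality
  using (_≡_; refl; sym; trans; cong; cong₂; subst; module ≡-Reasoning)
open import Relation.Nullary.Decidable using (toWitness; toWitnessFalse)

open import Algebra.Properties.CommutativeSemigroup +-commutativeSemigroup
  using (interchange; x∙yz≈y∙xz)
open ≡-Reasoning

prime[5] : Prime 5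
prime[5] = toWitness {a? = prime? 5} _

-- `applyUpTo` unfolds at its first term; the inductions on the length `k` split off the last one.
sum-applyUpTo-suc : ∀ f k → sum (applyUpTo f (suc k)) ≡ sum (applyUpTo f k) + f k
sum-applyUpTo-suc f k = begin
  sum (applyUpTo f (suc k))           ≡⟨ cong sum (applyUpTo-∷ʳ f k) ⟨
  sum (applyUpTo f k ∷ʳ f k)          ≡⟨ sum-++ (applyUpTo f k) _ ⟩
  sum (applyUpTo f k) + (f k + 0)     ≡⟨ cong (sum (applyUpTo f k) +_) (+-identityʳ (f k)) ⟩
  sum (applyUpTo f k) + f k           ∎

lucasSquareSum-suc : ∀ k n → lucasSquareSum (suc k) n ≡ lucasSquareSum k n + L (n + suc k) ^ 2
lucasSquareSum-suc k n = sum-applyUpTo-suc (λ j → L (n + suc j) ^ 2) k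

-- Identities between Lucas and Fibonacci numbers

L[n]+L[2+n]≡5F[1+n] : ∀ n → L n + L (2 + n) ≡ 5 * F (1 + n)
L[n]+L[2+n]≡5F[1+n] zero          = refl
L[n]+L[2+n]≡5F[1+n] (suc zero)    = refl
L[n]+L[2+n]≡5F[1+n] (suc (suc n)) = begin
  L (2 + n) + L (4 + n)                         ≡⟨ interchange (L (1 + n)) (L n) (L (3 + n)) (L (2 + n)) ⟩
  (L (1 + n) + L (3 + n)) + (L n + L (2 + n))   ≡⟨ cong₂ _+_ (L[n]+L[2+n]≡5F[1+n] (suc n)) (L[n]+L[2+n]≡5F[1+n] n) ⟩
  5 * F (2 + n) + 5 * F (1 + n)                 ≡⟨ *-distribˡ-+ 5 (F (2 + n)) (F (1 + n)) ⟨
  5 * F (3 + n)                                 ∎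

-- For fixed `n` both sides satisfy the Fibonacci recurrence in `m`, so the cases 0 and 1 decide.
-- The sums of squares use the diagonal `m = n`, but the induction must move one index alone.
LL+LL≡5F : ∀ m n → L m * L n + L (1 + m) * L (1 + n) ≡ 5 * F (1 + (m + n))
LL+LL≡5F zero n = trans (base (L n) (L (1 + n))) (L[n]+L[2+n]≡5F[1+n] n)
  where
  base : ∀ a b → 2 * a + 1 * b ≡ a + (b + a)
  base = solve-∀
LL+LL≡5F (suc zero) n = trans (base (L n) (L (1 + n))) (L[n]+L[2+n]≡5F[1+n] (suc n))
  where
  base : ∀ a b → 1 * a + 3 * b ≡ b + ((b + a) + b)
  base = solve-∀
LL+LL≡5F (suc (suc m)) n = begin
  L (2 + m) * L n + L (3 + m) * L (1 + n)
    ≡⟨ regroup (L (1 + m)) (L m) (L (2 + m)) (L n) (L (1 + n)) ⟩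
  (L (1 + m) * L n + L (2 + m) * L (1 + n)) + (L m * L n + L (1 + m) * L (1 + n))
    ≡⟨ cong₂ _+_ (LL+LL≡5F (suc m) n) (LL+LL≡5F m n) ⟩
  5 * F (2 + (m + n)) + 5 * F (1 + (m + n))
    ≡⟨ *-distribˡ-+ 5 (F (2 + (m + n))) (F (1 + (m + n))) ⟨
  5 * F (3 + (m + n)) ∎
  where
  regroup : ∀ a b c x y → (a + b) * x + (c + a) * y ≡ (a * x + c * y) + (b * x + a * y)
  regroup = solve-∀

-- Again both sides are Fibonacci-recurrent in `k`. This is the inductive step of
-- `lucasSquareSum-even`, up to the factor 5.
FF+F≡FF : ∀ k m → F k * F m + F (2 + (k + m)) ≡ F (2 + k) * F (2 + m)
FF+F≡FF zero m = sym (*-identityˡ (F (2 + m)))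
FF+F≡FF (suc zero) m = base (F m) (F (1 + m))
  where
  base : ∀ a b → 1 * a + ((b + a) + b) ≡ 2 * (b + a)
  base = solve-∀
FF+F≡FF (suc (suc k)) m = begin
  F (2 + k) * F m + F (4 + (k + m))
    ≡⟨ regroup (F (1 + k)) (F k) (F m) (F (3 + (k + m))) (F (2 + (k + m))) ⟩
  (F (1 + k) * F m + F (3 + (k + m))) + (F k * F m + F (2 + (k + m)))
    ≡⟨ cong₂ _+_ (FF+F≡FF (suc k) m) (FF+F≡FF k m) ⟩
  F (3 + k) * F (2 + m) + F (2 + k) * F (2 + m)
    ≡⟨ *-distribʳ-+ (F (2 + m)) (F (3 + k)) (F (2 + k)) ⟨
  F (4 + k) * F (2 + m) ∎
  where
  regroup : ∀ a b x c d → (a + b) * x + (c + d) ≡ (a * x + c) + (b * x + d)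
  regroup = solve-∀

F[k]+F[2+k]≡L[1+k] : ∀ k → F k + F (2 + k) ≡ L (1 + k)
F[k]+F[2+k]≡L[1+k] zero          = refl
F[k]+F[2+k]≡L[1+k] (suc zero)    = refl
F[k]+F[2+k]≡L[1+k] (suc (suc k)) = begin
  F (2 + k) + F (4 + k)                         ≡⟨ interchange (F (1 + k)) (F k) (F (3 + k)) (F (2 + k)) ⟩
  (F (1 + k) + F (3 + k)) + (F k + F (2 + k))   ≡⟨ cong₂ _+_ (F[k]+F[2+k]≡L[1+k] (suc k)) (F[k]+F[2+k]≡L[1+k] k) ⟩
  L (3 + k)                                     ∎

-- Closed forms for sums of Lucas squares

lucasSquareSum-even : ∀ j n → lucasSquareSum (j * 2) n ≡ 5 * F (j * 2) * F (n * 2 + suc (j * 2))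
lucasSquareSum-even zero    n = refl
lucasSquareSum-even (suc j) n = begin
  lucasSquareSum (2 + k) n
    ≡⟨ lucasSquareSum-suc (suc k) n ⟩
  lucasSquareSum (1 + k) n + L (n + suc (suc k)) ^ 2
    ≡⟨ cong₂ _+_ (lucasSquareSum-suc k n) (cong (λ i → L i ^ 2) (+-suc n (suc k))) ⟩
  lucasSquareSum k n + L p ^ 2 + L (suc p) ^ 2
    ≡⟨ cong (λ s → s + L p ^ 2 + L (suc p) ^ 2) (lucasSquareSum-even j n) ⟩
  5 * F k * F m + L p ^ 2 + L (suc p) ^ 2
    ≡⟨ squares (5 * F k * F m) (L p) (L (suc p)) ⟩
  5 * F k * F m + (L p * L p + L (suc p) * L (suc p))
    ≡⟨ cong (5 * F k * F m +_) (LL+LL≡5F p p) ⟩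
  5 * F k * F m + 5 * F (1 + (p + p))
    ≡⟨ cong (λ i → 5 * F k * F m + 5 * F i) (index n k) ⟩
  5 * F k * F m + 5 * F (2 + (k + m))
    ≡⟨ factor (F k) (F m) (F (2 + (k + m))) ⟩
  5 * (F k * F m + F (2 + (k + m)))
    ≡⟨ cong (5 *_) (FF+F≡FF k m) ⟩
  5 * (F (2 + k) * F (2 + m))
    ≡⟨ *-assoc 5 (F (2 + k)) (F (2 + m)) ⟨
  5 * F (2 + k) * F (2 + m)
    ≡⟨ cong (λ i → 5 * F (2 + k) * F i) (shift n k) ⟩
  5 * F (2 + k) * F (n * 2 + suc (2 + k)) ∎
  where
  k = j * 2
  p = n + suc k
  m = n * 2 + suc k
  -- The ring solver does not accept _^_; a * (a * 1) is the normal form of a ^ 2.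
  squares : ∀ s a b → s + a * (a * 1) + b * (b * 1) ≡ s + (a * a + b * b)
  squares = solve-∀
  index : ∀ n k → 1 + ((n + suc k) + (n + suc k)) ≡ 2 + (k + (n * 2 + suc k))
  index = solve-∀
  factor : ∀ a b c → 5 * a * b + 5 * c ≡ 5 * (a * b + c)
  factor = solve-∀
  shift : ∀ n k → 2 + (n * 2 + suc k) ≡ n * 2 + suc (2 + k)
  shift = solve-∀

-- Each square is a difference of products, L_i² = L_i L_{i+1} - L_{i-1} L_i. The 2 is the initial
-- product L_0 L_1, kept on the left to avoid subtraction.
lucasSquareSum-telescope : ∀ k → lucasSquareSum k 0 + 2 ≡ L k * L (1 + k)
lucasSquareSum-telescope zero    = refl
lucasSquareSum-telescope (suc k) = begin
  lucasSquareSum (suc k) 0 + 2                ≡⟨ cong (_+ 2) (lucasSquareSum-suc k 0) ⟩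
  lucasSquareSum k 0 + L (1 + k) ^ 2 + 2      ≡⟨ swap (lucasSquareSum k 0) (L (1 + k) ^ 2) ⟩
  lucasSquareSum k 0 + 2 + L (1 + k) ^ 2      ≡⟨ cong (_+ L (1 + k) ^ 2) (lucasSquareSum-telescope k) ⟩
  L k * L (1 + k) + L (1 + k) ^ 2             ≡⟨ factor (L k) (L (1 + k)) ⟩
  L (1 + k) * L (2 + k)                       ∎
  where
  swap : ∀ s b → s + b + 2 ≡ s + 2 + b
  swap = solve-∀
  factor : ∀ a b → a * b + b * (b * 1) ≡ b * (b + a)
  factor = solve-∀

lucasSquareSum-odd-pair : ∀ j n → let k = suc (j * 2) in
  lucasSquareSum k n + lucasSquareSum k (suc n) ≡ 5 * L k * F (n * 2 + suc (suc k))
lucasSquareSum-odd-pair j n = begin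
  S (1 + k) n + S (1 + k) (suc n)
    ≡⟨ cong (S (1 + k) n +_) (lucasSquareSum-suc k (suc n)) ⟩
  S (1 + k) n + (S k (suc n) + L (suc n + suc k) ^ 2)
    ≡⟨ cong (λ i → S (1 + k) n + (S k (suc n) + L i ^ 2)) (+-suc n (suc k)) ⟨
  S (1 + k) n + (S k (suc n) + L (n + suc (suc k)) ^ 2)
    -- The last square of the second sum is the one that would follow the first sum; moving it over
    -- makes both lengths even, and both closed forms then share the factor `F m`.
    ≡⟨ x∙yz≈y∙xz (S (1 + k) n) (S k (suc n)) (L (n + suc (suc k)) ^ 2) ⟩
  S k (suc n) + (S (1 + k) n + L (n + suc (suc k)) ^ 2)
    ≡⟨ cong (S k (suc n) +_) (lucasSquareSum-suc (suc k) n) ⟨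
  S k (suc n) + S (2 + k) n
    ≡⟨ cong₂ _+_ (lucasSquareSum-even j (suc n)) (lucasSquareSum-even (suc j) n) ⟩
  5 * F k * F (suc n * 2 + suc k) + 5 * F (2 + k) * F m
    ≡⟨ cong (λ i → 5 * F k * F i + 5 * F (2 + k) * F m) (index n k) ⟩
  5 * F k * F m + 5 * F (2 + k) * F m
    ≡⟨ factor (F k) (F (2 + k)) (F m) ⟩
  5 * (F k + F (2 + k)) * F m
    ≡⟨ cong (λ l → 5 * l * F m) (F[k]+F[2+k]≡L[1+k] k) ⟩
  5 * L (1 + k) * F m ∎
  where
  S = lucasSquareSum
  -- This `k` is one less than the odd `k` of the statement.
  k = j * 2
  m = n * 2 + suc (2 + k)
  index : ∀ n k → suc n * 2 + suc k ≡ n * 2 + suc (2 + k)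
  index = solve-∀
  factor : ∀ a b x → 5 * a * x + 5 * b * x ≡ 5 * (a + b) * x
  factor = solve-∀

-- Common divisors of the sums

-- Subtractive Euclidean algorithm: the recurrence carries the pair of indices down to `F 1 = 1` and
-- `F 0 = 0`.
∣aF[1+m]∧∣aF[m]⇒∣a : ∀ {c} a m → c ∣ a * F (1 + m) → c ∣ a * F m → c ∣ a
∣aF[1+m]∧∣aF[m]⇒∣a {c} a zero    p _ = subst (c ∣_) (*-identityʳ a) p
∣aF[1+m]∧∣aF[m]⇒∣a {c} a (suc m) p q = ∣aF[1+m]∧∣aF[m]⇒∣a a m q
  (∣m+n∣m⇒∣n (subst (c ∣_) (*-distribˡ-+ a (F (1 + m)) (F m)) p) q)

-- The values at `n = 0` and `n = 1` suffice: their difference is `a * F (1 + m)`, which gives two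
-- consecutive Fibonacci numbers.
∣aF[2n+m]⇒∣a : ∀ {c} a m → (∀ n → c ∣ a * F (n * 2 + m)) → c ∣ a
∣aF[2n+m]⇒∣a {c} a m c∣ = ∣aF[1+m]∧∣aF[m]⇒∣a a m
  (∣m+n∣m⇒∣n (subst (c ∣_) (distrib a (F (1 + m)) (F m)) (c∣ 1)) (c∣ 0)) (c∣ 0)
  where
  distrib : ∀ a x y → a * (x + y) ≡ a * y + a * x
  distrib = solve-∀

-- Since 5 divides `L n + L (2 + n)`, divisibility of a Lucas number by 5 would descend in steps of
-- two to 2 or 1.
5∤L : ∀ n → 5 ∤ L n
5∤L zero          = toWitnessFalse {a? = 5 ∣? 2} _
5∤L (suc zero)    = toWitnessFalse {a? = 5 ∣? 1} _
5∤L (suc (suc n)) 5∣L = 5∤L n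
  (∣m+n∣m⇒∣n (subst (5 ∣_) (trans (sym (L[n]+L[2+n]≡5F[1+n] n)) (+-comm (L n) _)) (m∣m*n (F (1 + n)))) 5∣L)

-- All terms but the last form a sum of even length, a multiple of 5, so 5 would have to divide the
-- last square.
5∤lucasSquareSum-odd : ∀ j → 5 ∤ lucasSquareSum (suc (j * 2)) 0
5∤lucasSquareSum-odd j 5∣S = [ 5∤L (suc k) , 5∤L (suc k) ]′ (euclidsLemma (L (suc k)) (L (suc k)) prime[5]
  (subst (5 ∣_) (cong (L (suc k) *_) (*-identityʳ (L (suc k)))) (∣m+n∣m⇒∣n (subst (5 ∣_) (lucasSquareSum-suc k 0) 5∣S) 5∣even)))
  where
  k = j * 2
  5∣even : 5 ∣ lucasSquareSum k 0
  5∣even = subst (5 ∣_) (sym (lucasSquareSum-even j 0)) (∣m⇒∣m*n (F (suc k)) (m∣m*n (F k)))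

odd-commonDivisor∣2 : ∀ j {c} → (∀ n → c ∣ lucasSquareSum (suc (j * 2)) n) → c ∣ 2
odd-commonDivisor∣2 j {c} c∣S = coprime-divisor coprime[c,5] c∣10
  where
  k = suc (j * 2)
  c∣5L : c ∣ 5 * L k
  c∣5L = ∣aF[2n+m]⇒∣a (5 * L k) (suc (suc k)) λ n →
    subst (c ∣_) (lucasSquareSum-odd-pair j n) (∣m∣n⇒∣m+n (c∣S n) (c∣S (suc n)))
  -- The telescoped sum is multiplied by 5 because only `5 * L k` is known to be a multiple of `c`.
  5LL≡5S+10 : 5 * L k * L (suc k) ≡ 5 * lucasSquareSum k 0 + 5 * 2
  5LL≡5S+10 = begin
    5 * L k * L (suc k)              ≡⟨ *-assoc 5 (L k) (L (suc k)) ⟩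
    5 * (L k * L (suc k))            ≡⟨ cong (5 *_) (lucasSquareSum-telescope k) ⟨
    5 * (lucasSquareSum k 0 + 2)     ≡⟨ *-distribˡ-+ 5 (lucasSquareSum k 0) 2 ⟩
    5 * lucasSquareSum k 0 + 5 * 2   ∎
  c∣10 : c ∣ 5 * 2
  c∣10 = ∣m+n∣m⇒∣n (subst (c ∣_) 5LL≡5S+10 (∣m⇒∣m*n (L (suc k)) c∣5L)) (∣n⇒∣m*n 5 (c∣S 0))
  coprime[c,5] : Coprime c 5
  coprime[c,5] (d∣c , d∣5) with prime⇒irreducible prime[5] d∣5
  ... | inj₁ d≡1  = d≡1
  ... | inj₂ refl = ⊥-elim (5∤lucasSquareSum-odd j (∣-trans d∣c (c∣S 0)))

-- Parity of the sums

lucasSquareSum-3+ : ∀ k n → ∃[ t ] lucasSquareSum (3 + k) n ≡ 2 * t + lucasSquareSum k n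
lucasSquareSum-3+ k n = t , (begin
  S (3 + k)
    ≡⟨ lucasSquareSum-suc (2 + k) n ⟩
  S (2 + k) + L (n + (3 + k)) ^ 2
    ≡⟨ cong (_+ L (n + (3 + k)) ^ 2) (lucasSquareSum-suc (1 + k) n) ⟩
  S (1 + k) + L (n + (2 + k)) ^ 2 + L (n + (3 + k)) ^ 2
    ≡⟨ cong (λ s → s + L (n + (2 + k)) ^ 2 + L (n + (3 + k)) ^ 2) (lucasSquareSum-suc k n) ⟩
  S k + L (n + (1 + k)) ^ 2 + L (n + (2 + k)) ^ 2 + L (n + (3 + k)) ^ 2
    ≡⟨ cong₂ _+_ (cong₂ (λ a b → S k + L a ^ 2 + L b ^ 2) (+-suc n k) (shift₂ n k))
                 (cong (λ a → L a ^ 2) (shift₃ n k)) ⟩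
  S k + L (1 + p) ^ 2 + L (2 + p) ^ 2 + L (3 + p) ^ 2
    ≡⟨ collect (S k) (L p) (L (1 + p)) ⟩
  2 * t + S k ∎)
  where
  S : ℕ → ℕ
  S i = lucasSquareSum i n
  p = n + k
  -- With x = `L p` and y = `L (1 + p)`, this is half of y² + (x + y)² + (x + 2y)², the three added
  -- squares.
  t = L p * L p + 3 * L p * L (1 + p) + 3 * L (1 + p) * L (1 + p)
  shift₂ : ∀ n k → n + (2 + k) ≡ 2 + (n + k)
  shift₂ = solve-∀
  shift₃ : ∀ n k → n + (3 + k) ≡ 3 + (n + k)
  shift₃ = solve-∀
  collect : ∀ s x y → s + y * (y * 1) + (y + x) * ((y + x) * 1) + ((y + x) + y) * (((y + x) + y) * 1)
                    ≡ 2 * (x * x + 3 * x * y + 3 * y * y) + s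
  collect = solve-∀

2∣lucasSquareSum-3q+ : ∀ q r n → 2 ∣ lucasSquareSum r n → 2 ∣ lucasSquareSum (q * 3 + r) n
2∣lucasSquareSum-3q+ zero    r n p = p
2∣lucasSquareSum-3q+ (suc q) r n p =
  let t , eq = lucasSquareSum-3+ (q * 3 + r) n
  in subst (2 ∣_) (sym eq) (∣m∣n⇒∣m+n (m∣m*n t) (2∣lucasSquareSum-3q+ q r n p))

2∤lucasSquareSum-3q+ : ∀ q r n → 2 ∤ lucasSquareSum r n → 2 ∤ lucasSquareSum (q * 3 + r) n
2∤lucasSquareSum-3q+ zero    r n p = p
2∤lucasSquareSum-3q+ (suc q) r n p 2∣S =
  let t , eq = lucasSquareSum-3+ (q * 3 + r) n
  in 2∤lucasSquareSum-3q+ q r n p (∣m+n∣m⇒∣n (subst (2 ∣_) eq 2∣S) (m∣m*n t))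

-- Greatest common divisors by residue of the length

isGCD-even : ∀ j → IsGCD (lucasSquareSum (j * 2)) (5 * F (j * 2))
isGCD-even j = record
  { commonDivisor = λ n → subst (5 * F k ∣_) (sym (lucasSquareSum-even j n)) (m∣m*n (F (n * 2 + suc k)))
  ; greatest      = λ {c} c∣S → ∣aF[2n+m]⇒∣a (5 * F k) (suc k) λ n →
                      subst (c ∣_) (lucasSquareSum-even j n) (c∣S n)
  }
  where k = j * 2

isGCD-odd-2 : ∀ j → (∀ n → 2 ∣ lucasSquareSum (suc (j * 2)) n) → IsGCD (lucasSquareSum (suc (j * 2))) 2
isGCD-odd-2 j 2∣S = record { commonDivisor = 2∣S ; greatest = odd-commonDivisor∣2 j }

-- Every common divisor divides the prime 2, so a single odd sum leaves only 1.
isGCD-odd-1 : ∀ j n → 2 ∤ lucasSquareSum (suc (j * 2)) n → IsGCD (lucasSquareSum (suc (j * 2))) 1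
isGCD-odd-1 j n 2∤S = record { commonDivisor = λ i → 1∣ S i ; greatest = greatest }
  where
  S : ℕ → ℕ
  S = lucasSquareSum (suc (j * 2))
  greatest : ∀ {c} → (∀ i → c ∣ S i) → c ∣ 1
  greatest c∣S =
    [ ∣-reflexive
    , (λ c≡2 → ⊥-elim (2∤S (subst (_∣ S n) c≡2 (c∣S n))))
    ]′ (prime⇒irreducible prime[2] (odd-commonDivisor∣2 j c∣S))

theorem5p4 : ∀ (k : ℕ) → 1 ≤ k →
    (2 ∣ k → IsGCD (lucasSquareSum k) (5 * F k))
    × (k % 6 ≡ 3 → IsGCD (lucasSquareSum k) 2)
    × (k % 6 ≡ 1 ⊎ k % 6 ≡ 5 → IsGCD (lucasSquareSum k) 1)
theorem5p4 k _ = even , three , [ one , five ]′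
  where
  q = k / 6

  k≡r+q*6 : ∀ {r} → k % 6 ≡ r → k ≡ r + q * 6
  k≡r+q*6 refl = m≡m%n+[m/n]*n k 6

  even : 2 ∣ k → IsGCD (lucasSquareSum k) (5 * F k)
  even (divides j refl) = isGCD-even j

  three : k % 6 ≡ 3 → IsGCD (lucasSquareSum k) 2
  -- Here k = 6q + 3 is read both as 2(3q + 1) + 1 and as 3(2q + 1) + 0; the parity reduces to that
  -- of the empty sum.
  three eq = subst (λ i → IsGCD (lucasSquareSum i) 2) (sym (trans (k≡r+q*6 eq) (halve q)))
    (isGCD-odd-2 (q * 3 + 1) λ n → subst (λ i → 2 ∣ lucasSquareSum i n) (mod3 q)
      (2∣lucasSquareSum-3q+ (q * 2 + 1) 0 n (2 ∣0)))
    where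
    halve : ∀ q → 3 + q * 6 ≡ suc ((q * 3 + 1) * 2)
    halve = solve-∀
    mod3 : ∀ q → (q * 2 + 1) * 3 + 0 ≡ suc ((q * 3 + 1) * 2)
    mod3 = solve-∀

  one : k % 6 ≡ 1 → IsGCD (lucasSquareSum k) 1
  -- Here k = 6q + 1 is read as 2(3q) + 1 and as 3(2q) + 1; the parity at start 0 reduces to that of
  -- L_1² = 1.
  one eq = subst (λ i → IsGCD (lucasSquareSum i) 1) (sym (trans (k≡r+q*6 eq) (halve q)))
    (isGCD-odd-1 (q * 3) 0 (subst (λ i → 2 ∤ lucasSquareSum i 0) (mod3 q)
      (2∤lucasSquareSum-3q+ (q * 2) 1 0 (toWitnessFalse {a? = 2 ∣? 1} _))))
    where
    halve : ∀ q → 1 + q * 6 ≡ suc ((q * 3) * 2)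
    halve = solve-∀
    mod3 : ∀ q → (q * 2) * 3 + 1 ≡ suc ((q * 3) * 2)
    mod3 = solve-∀

  -- For k ≡ 2 (mod 3) the sum starting at n = 0 is even, the one starting at n = 1 is odd.
  five : k % 6 ≡ 5 → IsGCD (lucasSquareSum k) 1
  five eq = subst (λ i → IsGCD (lucasSquareSum i) 1) (sym (trans (k≡r+q*6 eq) (halve q)))
    (isGCD-odd-1 (q * 3 + 2) 1 (subst (λ i → 2 ∤ lucasSquareSum i 1) (mod3 q)
      (2∤lucasSquareSum-3q+ (q * 2 + 1) 2 1 (toWitnessFalse {a? = 2 ∣? 25} _))))
    where
    halve : ∀ q → 5 + q * 6 ≡ suc ((q * 3 + 2) * 2)
    halve = solve-∀
    mod3 : ∀ q → (q * 2 + 1) * 3 + 2 ≡ suc ((q * 3 + 2) * 2)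
    mod3 = solve-∀
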